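{- For an array $A$ of length $n$, any data structure that encodes the solutions to range maximum-sum segment queries on $A$ must occupy at least $1.89113n - \Theta(\lg n)$ bits, if $n$ is sufficiently large.
   Context: For an array $A[1..n]$ of numbers let $S(i,j)=\sum_{k=i}^{j}A[k]$. A range maximum-sum segment query $\textsc{RMaxSSQ}(A,i,j)$, for $1\le i\le j\le n$, returns the endpoints of a subrange $[i',j']\subseteq[i,j]$ maximizing $S(i',j')$ (ties broken by returning the shortest, rightmost such range; the empty range if $A[i..j]$ has only non-positive entries). A data structure "encodes the solutions" to these queries if it can answer every query $\textsc{RMaxSSQ}(A,i,j)$ without access to $A$; the bound is on the number of bits such a structure needs in the worst case over arrays of length $n$. -}

module Defs where

open import Data.Nat as ℕ using (ℕ; _≤?_)
open import Data.Integer as ℤ using (ℤ; 0ℤ)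
open import Data.Fin using (Fin; toℕ)
open import Data.List using (List; map; filter; foldr; allFin)
open import Data.Maybe using (Maybe; just; nothing)
open import Data.Product using (_×_; _,_; ∃)
open import Data.Sum using (_⊎_)
open import Relation.Nullary.Decidable using (_×-dec_)
open import Relation.Binary.PropositionalEquality using (_≡_)

Array : ℕ → Set
Array n = Fin n → ℤ

S : ∀ {n} → Array n → Fin n → Fin n → ℤ
S {n} A i j =
  foldr ℤ._+_ 0ℤ
    (map A (filter (λ k → (toℕ i ≤? toℕ k) ×-dec (toℕ k ≤? toℕ j)) (allFin n)))

-- Length (minus one) of the segment [i',j'].
len : ∀ {n} → Fin n → Fin n → ℕ
len i j = toℕ j ℕ.∸ toℕ i

InRange : ∀ {n} → Fin n → Fin n → Fin n → Set
InRange i j k = toℕ i ℕ.≤ toℕ k × toℕ k ℕ.≤ toℕ j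

SubRange : ∀ {n} → Fin n → Fin n → Fin n → Fin n → Set
SubRange i j i' j' = toℕ i ℕ.≤ toℕ i' × toℕ i' ℕ.≤ toℕ j' × toℕ j' ℕ.≤ toℕ j

Preferred : ∀ {n} → Array n → (i' j' i'' j'' : Fin n) → Set
Preferred A i' j' i'' j'' =
  (S A i'' j'' ℤ.< S A i' j')
  ⊎ (S A i'' j'' ≡ S A i' j' ×
      ((len i' j' ℕ.< len i'' j'')
       ⊎ (len i'' j'' ≡ len i' j' × toℕ i'' ℕ.≤ toℕ i')))

-- r is the correct answer to RMaxSSQ(A,i,j); `nothing` is the empty range.
IsRMaxSSQ : ∀ {n} → Array n → Fin n → Fin n → Maybe (Fin n × Fin n) → Set
IsRMaxSSQ {n} A i j nothing = ∀ (k : Fin n) → InRange i j k → A k ℤ.≤ 0ℤ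
IsRMaxSSQ {n} A i j (just (i' , j')) =
  SubRange i j i' j' × 0ℤ ℤ.< S A i' j' ×
  (∀ (i'' j'' : Fin n) → SubRange i j i'' j'' → Preferred A i' j' i'' j'')

{-# OPTIONS --safe #-}

-- Arrays are built entry by entry.  Let D and M be the largest suffix sum and the
-- largest segment sum of the window from i up to the present end; after appending
-- v > 0 the answer to the query from i ends at the new entry iff v > M − D.  With t
-- distinct positive values of M − D there are thus t + 1 distinguishable positive
-- choices, and one negative choice.  Windows ending a run of s positive entries have
-- D = M, with s distinct values of M; a very negative entry resets every D to 0 and
-- turns each of these maxima into a threshold.  So the number of distinguishable
-- arrays satisfies the recurrence of count below, whose growth rate is 5 per entry;
-- already count 35 0 0 ≥ 2 ^ 67, and 67 / 35 > 1.89113.  Longer arrays are grown in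
-- independent blocks of 35 entries.
module Submission where

open import Defs
open import Data.Nat using (ℕ; NonZero; zero; suc; _+_; _*_; _∸_; _^_; _⊔_; _≤_; _<_; z≤n; s≤s; z<s; _<?_; _≤?_)
open import Data.Nat.DivMod using (_/_; _%_; m≡m%n+[m/n]*n; m%n<n)
open import Data.Nat.Properties
open import Data.Integer as ℤ using (ℤ; 0ℤ; +_; -_)
import Data.Integer.Properties as ℤ
open import Data.Fin using (Fin; toℕ; fromℕ<; funToFin; finToFun)
open import Data.Fin.Properties using (toℕ<n; toℕ-fromℕ<; toℕ-injective; injective⇒≤; finToFun-funToFin; 2↔Bool)
open import Data.Bool using (Bool; if_then_else_)
open import Data.Bool.Properties using (if-cong)
open import Data.Vec using (Vec)
import Data.Vec as Vec
import Data.Vec.Properties as Vec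
open import Data.Maybe using (Maybe; just; nothing)
open import Data.Product using (_×_; ∃; ∃-syntax; ∃₂; _,_; proj₁; proj₂)
open import Data.Sum using (_⊎_; inj₁; inj₂)
open import Data.List using (List; []; _∷_; _++_; map; length; lookup; filter; foldr; tabulate; zipWith; replicate)
open import Data.List.Properties using (length-++; length-map)
open import Data.List.Relation.Unary.All as All using (All; []; _∷_)
import Data.List.Relation.Unary.All.Properties as All
open import Data.List.Relation.Unary.AllPairs as AllPairs using (AllPairs; []; _∷_)
import Data.List.Relation.Unary.AllPairs.Properties as AllPairs
open import Data.List.Membership.Propositional.Properties using (∈-lookup)
open import Data.List.Relation.Unary.Any using (Any; here; there)
open import Relation.Nullary using (¬_; yes; no; does; contradiction)
open import Relation.Nullary.Decidable using (_×-dec_; dec-true; dec-false)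
open import Relation.Binary.PropositionalEquality
open import Function using (_∘_; id; _↣_; Injection)
open import Function.Properties.Inverse using (↔-sym; ↔⇒↣)

-- Signals, segment sums and Kadane's recurrences.

data Step : Set where
  up down : ℕ → Step

value : Step → ℤ
value (up v)   = + v
value (down w) = - (+ w)

scale : ℕ → Step → Step
scale c (up v)   = up (c * v)
scale c (down w) = down (c * w)

-- Infinite sequences, so that arrays of all lengths share one type and appending an entry needs no
-- transport.
Signal : Set
Signal = ℕ → Step

array : ∀ {n} → Signal → Array n
array a k = value (a (toℕ k))

sum : Signal → ℕ → ℕ → ℤ
sum a i zero    = 0ℤ
sum a i (suc l) = sum a i l ℤ.+ value (a (i + l))

-- Truncated subtraction is Kadane's restart: a suffix sum that would turn negative gives way to the
-- empty suffix.
_▹_ : ℕ → Step → ℕ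
d ▹ up v   = d + v
d ▹ down w = d ∸ w

-- Kadane's recurrences on the l entries from position i on, with the empty segment
-- (of sum 0) allowed.
D : Signal → ℕ → ℕ → ℕ
D a i zero    = 0
D a i (suc l) = D a i l ▹ a (i + l)

M : Signal → ℕ → ℕ → ℕ
M a i zero    = 0
M a i (suc l) = M a i l ⊔ D a i (suc l)

-- Kadane's values as maximal suffix and segment sums.

⊖-≤-∸ : ∀ m n → m ℤ.⊖ n ℤ.≤ + (m ∸ n)
⊖-≤-∸ m n with ≤-total n m
... | inj₁ n≤m = ℤ.≤-reflexive (ℤ.⊖-≥ n≤m)
... | inj₂ m≤n = ℤ.≤-trans (ℤ.⊖-monoˡ-≤ n m≤n)
                   (ℤ.≤-trans (ℤ.≤-reflexive (ℤ.n⊖n≡0 n)) (ℤ.+≤+ z≤n))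

▹-upper : ∀ {x d} s → x ℤ.≤ + d → x ℤ.+ value s ℤ.≤ + (d ▹ s)
▹-upper (up v)       x≤d = ℤ.+-monoˡ-≤ (+ v) x≤d
▹-upper {d = d} (down w) x≤d = ℤ.≤-trans (ℤ.+-monoˡ-≤ (- (+ w)) x≤d)
  (ℤ.≤-trans (ℤ.≤-reflexive (ℤ.m-n≡m⊖n d w)) (⊖-≤-∸ d w))

▹-attained : ∀ d s → + d ℤ.+ value s ≡ + (d ▹ s) ⊎ d ▹ s ≡ 0
▹-attained d (up v) = inj₁ refl
▹-attained d (down w) with ≤-total w d
... | inj₁ w≤d = inj₁ (trans (ℤ.m-n≡m⊖n d w) (ℤ.⊖-≥ w≤d))
... | inj₂ d≤w = inj₂ (m≤n⇒m∸n≡0 d≤w)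

D-upper : ∀ a i s l → sum a (i + s) l ℤ.≤ + D a i (s + l)
D-upper a i s zero = ℤ.+≤+ z≤n
D-upper a i s (suc l) rewrite +-suc s l | +-assoc i s l =
  ▹-upper (a (i + (s + l))) (D-upper a i s l)

D-attained : ∀ a i l → ∃₂ λ s k → s + k ≡ l × sum a (i + s) k ≡ + D a i l
D-attained a i zero = 0 , 0 , refl , refl
D-attained a i (suc l) with ▹-attained (D a i l) (a (i + l))
... | inj₂ eq = suc l , 0 , +-identityʳ (suc l) , cong +_ (sym eq)
... | inj₁ eq with D-attained a i l
...   | s , k , refl , attained =
  s , suc k , +-suc s k ,
  trans (cong₂ ℤ._+_ attained (cong (value ∘ a) (+-assoc i s k))) eq

D≤M : ∀ a i l → D a i l ≤ M a i l
D≤M a i zero    = z≤n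
D≤M a i (suc l) = m≤n⊔m (M a i l) (D a i (suc l))

M-mono : ∀ a i l e → M a i l ≤ M a i (l + e)
M-mono a i l zero = ≤-reflexive (cong (M a i) (sym (+-identityʳ l)))
M-mono a i l (suc e) rewrite +-suc l e =
  ≤-trans (M-mono a i l e) (m≤m⊔n (M a i (l + e)) (D a i (suc (l + e))))

M-upper : ∀ a i s l e → sum a (i + s) l ℤ.≤ + M a i (s + l + e)
M-upper a i s l e = ℤ.≤-trans (D-upper a i s l)
  (ℤ.+≤+ (≤-trans (D≤M a i (s + l)) (M-mono a i (s + l) e)))

M-attained : ∀ a i l → ∃ λ s → ∃₂ λ k e → s + k + e ≡ l × sum a (i + s) k ≡ + M a i l
M-attained a i zero = 0 , 0 , 0 , refl , refl
M-attained a i (suc l) with ≤-total (D a i (suc l)) (M a i l)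
... | inj₁ D≤ with M-attained a i l
...   | s , k , e , refl , attained =
  s , k , suc e , +-suc (s + k) e , trans attained (cong +_ (sym (m≥n⇒m⊔n≡m D≤)))
M-attained a i (suc l) | inj₂ M≤ with D-attained a i (suc l)
...   | s , k , eq , attained =
  s , k , 0 , trans (+-identityʳ (s + k)) eq , trans attained (cong +_ (sym (m≤n⇒m⊔n≡n M≤)))

sum-nonpositive : ∀ a x l → (∀ k → k < l → value (a (x + k)) ℤ.≤ 0ℤ) → sum a x l ℤ.≤ 0ℤ
sum-nonpositive a x zero    neg = ℤ.≤-refl
sum-nonpositive a x (suc l) neg =
  ℤ.+-mono-≤ (sum-nonpositive a x l (λ k k<l → neg k (m<n⇒m<1+n k<l))) (neg l ≤-refl)

-- Filtered sums as sums over consecutive positions.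

module _ (a : Signal) (i j : ℕ) where

  masked : ℕ → ℤ
  masked k = if does ((i ≤? k) ×-dec (k ≤? j)) then value (a k) else 0ℤ

  maskedSum : ℕ → ℕ → ℤ
  maskedSum o zero    = 0ℤ
  maskedSum o (suc n) = masked o ℤ.+ maskedSum (suc o) n

  -- `allFin` unfolds to `tabulate` along shifted embeddings, so the induction runs over an
  -- arbitrary `f` with its offset `o`.
  filter-masked : ∀ {N} n o (f : Fin n → Fin N) → (∀ k → toℕ (f k) ≡ o + toℕ k) →
    foldr ℤ._+_ 0ℤ
      (map (array a) (filter (λ k → (i ≤? toℕ k) ×-dec (toℕ k ≤? j)) (tabulate f)))
    ≡ maskedSum o n
  filter-masked zero    o f eq = refl
  filter-masked (suc n) o f eq
    with ih ← filter-masked n (suc o) (f ∘ Fin.suc)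
                (λ k → trans (eq (Fin.suc k)) (+-suc o (toℕ k)))
    rewrite trans (eq Fin.zero) (+-identityʳ o)
    with does ((i ≤? o) ×-dec (o ≤? j))
  ... | Bool.true  = cong₂ ℤ._+_ (cong (value ∘ a) (trans (eq Fin.zero) (+-identityʳ o))) ih
  ... | Bool.false = trans ih (sym (ℤ.+-identityˡ _))

  -- `foldr` takes entries off at the left while `sum` grows at the right; this changes sides.
  maskedSum-snoc : ∀ o n → maskedSum o (suc n) ≡ maskedSum o n ℤ.+ masked (o + n)
  maskedSum-snoc o zero rewrite +-identityʳ o = ℤ.+-comm (masked o) 0ℤ
  maskedSum-snoc o (suc n)
    rewrite maskedSum-snoc (suc o) n | +-suc o n =
    sym (ℤ.+-assoc (masked o) (maskedSum (suc o) n) (masked (suc (o + n))))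

  masked-in : ∀ {k} → i ≤ k → k ≤ j → masked k ≡ value (a k)
  masked-in {k} i≤k k≤j = if-cong (dec-true ((i ≤? k) ×-dec (k ≤? j)) (i≤k , k≤j))

  masked-out : ∀ {k} → ¬ (i ≤ k × k ≤ j) → masked k ≡ 0ℤ
  masked-out {k} out = if-cong (dec-false ((i ≤? k) ×-dec (k ≤? j)) out)

  maskedSum-before : ∀ n → n ≤ i → maskedSum 0 n ≡ 0ℤ
  maskedSum-before zero    n≤i = refl
  maskedSum-before (suc n) n<i = trans (maskedSum-snoc 0 n)
    (cong₂ ℤ._+_ (maskedSum-before n (<⇒≤ n<i)) (masked-out (λ (i≤n , _) → <⇒≱ n<i i≤n)))

  maskedSum-inside : ∀ l → i + l ≤ suc j → maskedSum 0 (i + l) ≡ sum a i l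
  maskedSum-inside zero _ rewrite +-identityʳ i = maskedSum-before i ≤-refl
  maskedSum-inside (suc l) le rewrite +-suc i l = trans (maskedSum-snoc 0 (i + l))
    (cong₂ ℤ._+_ (maskedSum-inside l (<⇒≤ le)) (masked-in (m≤m+n i l) (≤-pred le)))

  maskedSum-after : ∀ e → maskedSum 0 (suc j + e) ≡ maskedSum 0 (suc j)
  maskedSum-after zero = cong (maskedSum 0) (+-identityʳ (suc j))
  maskedSum-after (suc e) rewrite +-suc j e = trans (maskedSum-snoc 0 (suc j + e))
    (trans (cong₂ ℤ._+_ (maskedSum-after e) (masked-out (λ (_ , le) → m+n≮m j e le)))
      (ℤ.+-identityʳ _))

S-sum : ∀ {n} a (i j : Fin n) {l} → toℕ i + l ≡ toℕ j → S (array a) i j ≡ sum a (toℕ i) (suc l)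
S-sum {n} a i j {l} eq = begin
  S (array a) i j                       ≡⟨ filter-masked a (toℕ i) (toℕ j) n 0 id (λ _ → refl) ⟩
  U n                                   ≡⟨ cong U (m+[n∸m]≡n (toℕ<n j)) ⟨
  U (suc (toℕ j) + (n ∸ suc (toℕ j)))   ≡⟨ maskedSum-after a (toℕ i) (toℕ j) _ ⟩
  U (suc (toℕ j))                       ≡⟨ cong U end ⟨
  U (toℕ i + suc l)                     ≡⟨ maskedSum-inside a (toℕ i) (toℕ j) (suc l) (≤-reflexive end) ⟩
  sum a (toℕ i) (suc l)                 ∎
  where
  open ≡-Reasoning
  U = maskedSum a (toℕ i) (toℕ j) 0
  end : toℕ i + suc l ≡ suc (toℕ j)
  end = trans (+-suc (toℕ i) l) (cong suc eq)

-- Where the answer to a query ends.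

EndsAtLast : Signal → ℕ → ℕ → Set
EndsAtLast a i l = M a i l < D a i (suc l)

-- The second alternative covers windows in which no segment ending at the last entry is positive,
-- also those with an empty answer. A positive tie falls under neither predicate; the entries
-- appended later are chosen to avoid it.
EndsEarlier : Signal → ℕ → ℕ → Set
EndsEarlier a i l = D a i (suc l) < M a i l ⊎ D a i (suc l) ≡ 0

segment-≤M : ∀ a {i x y l} → i ≤ x → x ≤ y → y < i + l → sum a x (suc (y ∸ x)) ℤ.≤ + M a i l
segment-≤M a {i} {x} {y} {l} i≤x x≤y y<i+l
  with s , refl ← m≤n⇒∃[o]m+o≡n i≤x
  with k , refl ← m≤n⇒∃[o]m+o≡n x≤y
  with e , eq ← m≤n⇒∃[o]m+o≡n y<i+l
  rewrite m+n∸m≡n (i + s) k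
  = subst (λ l → sum a (i + s) (suc k) ℤ.≤ + M a i l) (+-cancelˡ-≡ i _ _ total) (M-upper a i s (suc k) e)
  where
  total : i + (s + suc k + e) ≡ i + l
  total = begin
    i + (s + suc k + e)    ≡⟨ +-assoc i (s + suc k) e ⟨
    i + (s + suc k) + e    ≡⟨ cong (_+ e) (+-assoc i s (suc k)) ⟨
    i + s + suc k + e      ≡⟨ cong (_+ e) (+-suc (i + s) k) ⟩
    suc (i + s + k) + e    ≡⟨ eq ⟩
    i + l                  ∎
    where open ≡-Reasoning

preferred-≥ : ∀ {n} (A : Array n) {i' j' i'' j''} → Preferred A i' j' i'' j'' → S A i'' j'' ℤ.≤ S A i' j'
preferred-≥ A (inj₁ lt)       = ℤ.<⇒≤ lt
preferred-≥ A (inj₂ (eq , _)) = ℤ.≤-reflexive eq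

module _ {n} (a : Signal) {i j : Fin n} {l} (i+l≡j : toℕ i + l ≡ toℕ j) where

  private
    A : Array n
    A = array a

    window-end : toℕ i + suc l ≡ suc (toℕ j)
    window-end = trans (+-suc (toℕ i) l) (cong suc i+l≡j)

  -- Turns the offsets supplied by `D-attained` and `M-attained` into endpoints that compete in the
  -- query.
  realize : ∀ s k e → s + suc k + e ≡ suc l →
    ∃₂ λ x y → SubRange i j x y × S A x y ≡ sum a (toℕ i + s) (suc k)
  realize s k e eq = x , y ,
    ( subst (toℕ i ≤_) (sym x≡) (m≤m+n (toℕ i) s)
    , subst₂ _≤_ (sym x≡) (sym y≡) (m≤m+n (toℕ i + s) k)
    , subst (_≤ toℕ j) (sym y≡) ends) ,
    trans (S-sum a x y (trans (cong (_+ k) x≡) (sym y≡))) (cong (λ o → sum a o (suc k)) x≡)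
    where
    total : toℕ i + s + k + e ≡ toℕ j
    total = suc-injective (begin
      suc (toℕ i + s + k) + e    ≡⟨ cong (_+ e) (+-suc (toℕ i + s) k) ⟨
      toℕ i + s + suc k + e      ≡⟨ cong (_+ e) (+-assoc (toℕ i) s (suc k)) ⟩
      toℕ i + (s + suc k) + e    ≡⟨ +-assoc (toℕ i) (s + suc k) e ⟩
      toℕ i + (s + suc k + e)    ≡⟨ cong (_+_ (toℕ i)) eq ⟩
      toℕ i + suc l              ≡⟨ window-end ⟩
      suc (toℕ j)                ∎)
      where open ≡-Reasoning
    ends : toℕ i + s + k ≤ toℕ j
    ends = m+n≤o⇒m≤o (toℕ i + s + k) (≤-reflexive total)
    y<n : toℕ i + s + k < n
    y<n = ≤-<-trans ends (toℕ<n j)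
    x<n : toℕ i + s < n
    x<n = ≤-<-trans (m≤m+n (toℕ i + s) k) y<n
    x y : Fin n
    x = fromℕ< x<n
    y = fromℕ< y<n
    x≡ : toℕ x ≡ toℕ i + s
    x≡ = toℕ-fromℕ< x<n
    y≡ : toℕ y ≡ toℕ i + s + k
    y≡ = toℕ-fromℕ< y<n

  S-sub : ∀ {x y} → SubRange i j x y → S A x y ≡ sum a (toℕ x) (suc (toℕ y ∸ toℕ x))
  S-sub {x} {y} (_ , x≤y , _) = S-sum a x y (m+[n∸m]≡n x≤y)

  -- `D` is attained by a competing segment. An empty answer would make that segment nonpositive,
  -- and an answer ending before `j` has sum at most `M`, which is below `D`.
  answer-last : EndsAtLast a (toℕ i) l → ∀ {r} → IsRMaxSSQ A i j r → ∃ λ x → r ≡ just (x , j)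
  answer-last M<D {r} correct with D-attained a (toℕ i) (suc l)
  -- If the empty suffix attained `D`, then `D` would be 0, which cannot exceed `M`.
  ... | s , zero , _ , 0≡D = contradiction (subst (M a (toℕ i) l <_) (sym (ℤ.+-injective 0≡D)) M<D) (λ ())
  answer-last M<D {nothing} correct | s , suc k , eq , sum≡D
    with x , y , (i≤x , x≤y , y≤j) , S≡ ← realize s k 0 (trans (+-identityʳ _) eq) =
    contradiction
      (ℤ.≤-trans (ℤ.≤-reflexive (sym sum≡D)) (sum-nonpositive a (toℕ i + s) (suc k) nonpositive))
      (ℤ.<⇒≱ (ℤ.+<+ (≤-<-trans z≤n M<D)))
    where
    nonpositive : ∀ o → o < suc k → value (a (toℕ i + s + o)) ℤ.≤ 0ℤ
    nonpositive o o≤k = subst (λ p → value (a p) ℤ.≤ 0ℤ) p≡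
      (correct p (subst (toℕ i ≤_) (sym p≡) i≤p , subst (_≤ toℕ j) (sym p≡) p≤j))
      where
      i≤p : toℕ i ≤ toℕ i + s + o
      i≤p = ≤-trans (m≤m+n (toℕ i) s) (m≤m+n (toℕ i + s) o)
      p≤j : toℕ i + s + o ≤ toℕ j
      p≤j = ≤-pred (begin
        suc (toℕ i + s + o)   ≡⟨ +-suc (toℕ i + s) o ⟨
        toℕ i + s + suc o     ≤⟨ +-monoʳ-≤ (toℕ i + s) o≤k ⟩
        toℕ i + s + suc k     ≡⟨ +-assoc (toℕ i) s (suc k) ⟩
        toℕ i + (s + suc k)   ≡⟨ cong (_+_ (toℕ i)) eq ⟩
        toℕ i + suc l         ≡⟨ window-end ⟩
        suc (toℕ j)           ∎)
        where open ≤-Reasoning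
      p<n : toℕ i + s + o < n
      p<n = ≤-<-trans p≤j (toℕ<n j)
      p : Fin n
      p = fromℕ< p<n
      p≡ : toℕ p ≡ toℕ i + s + o
      p≡ = toℕ-fromℕ< p<n
  answer-last M<D {just (i' , j')} (sub@(i≤i' , i'≤j' , j'≤j) , _ , best) | s , suc k , eq , sum≡D
    with x , y , sub′ , S≡ ← realize s k 0 (trans (+-identityʳ _) eq)
    with toℕ j' <? toℕ j
  ... | no j'≮j = i' , cong (λ z → just (i' , z)) (toℕ-injective (≤∧≮⇒≡ j'≤j j'≮j))
  ... | yes j'<j = contradiction (ℤ.drop‿+≤+ D≤M′) (<⇒≱ M<D)
    where
    D≤M′ : + D a (toℕ i) (suc l) ℤ.≤ + M a (toℕ i) l
    D≤M′ = begin
      + D a (toℕ i) (suc l)                        ≡⟨ trans S≡ sum≡D ⟨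
      S A x y                                      ≤⟨ preferred-≥ A (best x y sub′) ⟩
      S A i' j'                                    ≡⟨ S-sub sub ⟩
      sum a (toℕ i') (suc (toℕ j' ∸ toℕ i'))       ≤⟨ segment-≤M a i≤i' i'≤j' (subst (toℕ j' <_) (sym i+l≡j) j'<j) ⟩
      + M a (toℕ i) l                              ∎
      where open ℤ.≤-Reasoning

  -- A segment ending at `j` has sum at most `D`. If `D` is 0 it is not positive; otherwise the
  -- segment attaining `M` beats it.
  answer-earlier : EndsEarlier a (toℕ i) l → ∀ {x} → ¬ IsRMaxSSQ A i j (just (x , j))
  answer-earlier earlier {x} (sub@(i≤x , x≤j , _) , 0<S , best) = conclude earlier
    where
    S≤D : S A x j ℤ.≤ + D a (toℕ i) (suc l)
    S≤D with s , i+s≡x ← m≤n⇒∃[o]m+o≡n i≤x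
        with k , x+k≡j ← m≤n⇒∃[o]m+o≡n x≤j =
      subst₂ ℤ._≤_
        (sym (trans (S-sum a x j x+k≡j) (cong (λ o → sum a o (suc k)) (sym i+s≡x))))
        (cong (λ o → + D a (toℕ i) o) (+-cancelˡ-≡ (toℕ i) _ _ total))
        (D-upper a (toℕ i) s (suc k))
      where
      total : toℕ i + (s + suc k) ≡ toℕ i + suc l
      total = begin
        toℕ i + (s + suc k)   ≡⟨ +-assoc (toℕ i) s (suc k) ⟨
        toℕ i + s + suc k     ≡⟨ cong (_+ suc k) i+s≡x ⟩
        toℕ x + suc k         ≡⟨ +-suc (toℕ x) k ⟩
        suc (toℕ x + k)       ≡⟨ cong suc x+k≡j ⟩
        suc (toℕ j)           ≡⟨ window-end ⟨
        toℕ i + suc l         ∎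
        where open ≡-Reasoning
    conclude : ¬ EndsEarlier a (toℕ i) l
    conclude (inj₂ D≡0) = ℤ.<⇒≱ 0<S (ℤ.≤-trans S≤D (ℤ.≤-reflexive (cong +_ D≡0)))
    conclude (inj₁ D<M) with M-attained a (toℕ i) l
    ... | s , zero , e , eq , 0≡M = contradiction (subst (D a (toℕ i) (suc l) <_) (sym (ℤ.+-injective 0≡M)) D<M) (λ ())
    ... | s , suc k , e , eq , sum≡M
      -- `M` covers one entry less than the query does, hence `suc e`.
      with u , v , sub′ , S≡ ← realize s k (suc e) (trans (+-suc _ e) (cong suc eq)) =
      <⇒≱ D<M (ℤ.drop‿+≤+ (begin
        + M a (toℕ i) l         ≡⟨ trans S≡ sum≡M ⟨
        S A u v                 ≤⟨ preferred-≥ A (best u v sub′) ⟩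
        S A x j                 ≤⟨ S≤D ⟩
        + D a (toℕ i) (suc l)   ∎))
      where open ℤ.≤-Reasoning

-- Separated signals.

Separated : ℕ → Signal → Signal → Set
Separated n a b = ∃₂ λ i l → i + l < n ×
  (EndsAtLast a i l × EndsEarlier b i l ⊎ EndsEarlier a i l × EndsAtLast b i l)

-- At the separating query every correct answer for one signal ends at the last entry and none for
-- the other does.
separated-answers : ∀ {n a b} → Separated n a b →
  ∃₂ λ (i j : Fin n) → toℕ i ≤ toℕ j × (∀ {r} → IsRMaxSSQ (array a) i j r → ¬ IsRMaxSSQ (array b) i j r)
separated-answers {n} {a} {b} (i , l , i+l<n , differ) =
  x , y , subst (toℕ x ≤_) x+l≡y (m≤m+n (toℕ x) l) , clash differ
  where
  i<n : i < n
  i<n = ≤-<-trans (m≤m+n i l) i+l<n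
  x y : Fin n
  x = fromℕ< i<n
  y = fromℕ< i+l<n
  x≡ : toℕ x ≡ i
  x≡ = toℕ-fromℕ< i<n
  x+l≡y : toℕ x + l ≡ toℕ y
  x+l≡y = trans (cong (_+ l) x≡) (sym (toℕ-fromℕ< i+l<n))
  clash : (EndsAtLast a i l × EndsEarlier b i l ⊎ EndsEarlier a i l × EndsAtLast b i l) →
    ∀ {r} → IsRMaxSSQ (array a) x y r → ¬ IsRMaxSSQ (array b) x y r
  clash (inj₁ (last , earlier)) ra rb
    with _ , refl ← answer-last a x+l≡y (subst (λ o → EndsAtLast a o l) (sym x≡) last) ra =
    answer-earlier b x+l≡y (subst (λ o → EndsEarlier b o l) (sym x≡) earlier) rb
  clash (inj₂ (earlier , last)) ra rb
    with _ , refl ← answer-last b x+l≡y (subst (λ o → EndsAtLast b o l) (sym x≡) last) rb =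
    answer-earlier a x+l≡y (subst (λ o → EndsEarlier a o l) (sym x≡) earlier) ra

-- Scaling and appending entries.

scale-scale : ∀ c d s → scale d (scale c s) ≡ scale (d * c) s
scale-scale c d (up v)   = cong up (sym (*-assoc d c v))
scale-scale c d (down w) = cong down (sym (*-assoc d c w))

▹-scale : ∀ c d s → (c * d) ▹ scale c s ≡ c * (d ▹ s)
▹-scale c d (up v)   = sym (*-distribˡ-+ c d v)
▹-scale c d (down w) = sym (*-distribˡ-∸ c d w)

-- Agreement up to a factor, since a positive factor preserves all comparisons between `D` and `M`;
-- `suc c` keeps it positive.
Extends : ℕ → Signal → Signal → Set
Extends n a b = ∃ λ c → ∀ {k} → k < n → b k ≡ scale (suc c) (a k)

extends-refl : ∀ {n a} → Extends n a a
extends-refl {a = a} = 0 , λ {k} _ → unit (a k)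
  where
  unit : ∀ s → s ≡ scale 1 s
  unit (up v)   = cong up (sym (*-identityˡ v))
  unit (down w) = cong down (sym (*-identityˡ w))

extends-trans : ∀ {m n a b c} → m ≤ n → Extends m a b → Extends n b c → Extends m a c
extends-trans {a = a} m≤n (c , eq) (d , eq′) = c + d * suc c , λ {k} k<m →
  trans (eq′ (<-≤-trans k<m m≤n)) (trans (cong (scale (suc d)) (eq k<m)) (scale-scale (suc c) (suc d) (a k)))

module _ {n a b} (ext : Extends n a b) where

  private
    c : ℕ
    c = suc (proj₁ ext)

  D-extends : ∀ {i} l → i + l ≤ n → D b i l ≡ c * D a i l
  D-extends     zero    _  = sym (*-zeroʳ c)
  D-extends {i} (suc l) le rewrite +-suc i l =
    trans (cong₂ _▹_ (D-extends l (<⇒≤ le)) (proj₂ ext le)) (▹-scale c (D a i l) (a (i + l)))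

  M-extends : ∀ {i} l → i + l ≤ n → M b i l ≡ c * M a i l
  M-extends     zero    _  = sym (*-zeroʳ c)
  M-extends {i} (suc l) le = trans
    (cong₂ _⊔_ (M-extends l (≤-trans (+-monoʳ-≤ i (n≤1+n l)) le)) (D-extends (suc l) le))
    (sym (*-distribˡ-⊔ c (M a i l) (D a i (suc l))))

  endsAtLast-extends : ∀ {i} l → i + l < n → EndsAtLast a i l → EndsAtLast b i l
  endsAtLast-extends {i} l lt M<D =
    subst₂ _<_ (sym (M-extends l (<⇒≤ lt))) (sym (D-extends (suc l) (subst (_≤ n) (sym (+-suc i l)) lt)))
      (*-monoʳ-< c M<D)

  endsEarlier-extends : ∀ {i} l → i + l < n → EndsEarlier a i l → EndsEarlier b i l
  endsEarlier-extends {i} l lt (inj₁ D<M) = inj₁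
    (subst₂ _<_ (sym (D-extends (suc l) (subst (_≤ n) (sym (+-suc i l)) lt))) (sym (M-extends l (<⇒≤ lt)))
      (*-monoʳ-< c D<M))
  endsEarlier-extends {i} l lt (inj₂ D≡0) = inj₂
    (trans (D-extends (suc l) (subst (_≤ n) (sym (+-suc i l)) lt)) (trans (cong (c *_) D≡0) (*-zeroʳ c)))

separated-extends : ∀ {m n a b a′ b′} → m ≤ n → Separated m a b →
  Extends m a a′ → Extends m b b′ → Separated n a′ b′
separated-extends m≤n (i , l , lt , inj₁ (last , earlier)) ea eb =
  i , l , <-≤-trans lt m≤n , inj₁ (endsAtLast-extends ea l lt last , endsEarlier-extends eb l lt earlier)
separated-extends m≤n (i , l , lt , inj₂ (earlier , last)) ea eb =
  i , l , <-≤-trans lt m≤n , inj₂ (endsEarlier-extends ea l lt earlier , endsAtLast-extends eb l lt last)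

-- Doubling the entries already present makes room for an integer strictly between
-- any two consecutive thresholds.
push : ℕ → Step → Signal → Signal
push n s a k = if does (k <? n) then scale 2 (a k) else s

push-extends : ∀ n s a → Extends n a (push n s a)
push-extends n s a = 1 , λ {k} k<n → if-cong (dec-true (k <? n) k<n)

push-last : ∀ n s a → push n s a n ≡ s
push-last n s a = if-cong (dec-false (n <? n) (<-irrefl refl))

-- Windows reaching the present end.

Window : ℕ → Signal → ℕ → ℕ → Set
Window n a d m = ∃₂ λ i l → i + l ≡ n × D a i l ≡ d × M a i l ≡ m

module _ {n a d m} (s : Step) (window : Window n a d m) where

  private
    i l : ℕ
    i = proj₁ window
    l = proj₁ (proj₂ window)
    end : i + l ≡ n
    end = proj₁ (proj₂ (proj₂ window))

  M-push : M (push n s a) i l ≡ 2 * m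
  M-push = trans (M-extends (push-extends n s a) l (≤-reflexive end))
    (cong (2 *_) (proj₂ (proj₂ (proj₂ (proj₂ window)))))

  D-push : D (push n s a) i (suc l) ≡ (2 * d) ▹ s
  D-push = cong₂ _▹_
    (trans (D-extends (push-extends n s a) l (≤-reflexive end))
      (cong (2 *_) (proj₁ (proj₂ (proj₂ (proj₂ window))))))
    (trans (cong (push n s a) end) (push-last n s a))

  window-push : Window (suc n) (push n s a) ((2 * d) ▹ s) ((2 * m) ⊔ ((2 * d) ▹ s))
  window-push = i , suc l , trans (+-suc i l) (cong suc end) , D-push , cong₂ _⊔_ M-push D-push

window-empty : ∀ n a → Window n a 0 0
window-empty n a = n , 0 , +-identityʳ n , refl , refl

-- The query from the start of the window to the new entry tells the two choices apart, with `M - D`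
-- as the threshold between them.
separated-push : ∀ {n a d m s s′} → Window n a d m →
  (2 * d) ▹ s < 2 * m ⊎ (2 * d) ▹ s ≡ 0 → 2 * m < (2 * d) ▹ s′ →
  Separated (suc n) (push n s a) (push n s′ a)
separated-push {s = s} {s′} w@(i , l , end , _) earlier last =
  i , l , s≤s (≤-reflexive end) , inj₂ (endsEarlier earlier , subst₂ _<_ (sym (M-push s′ w)) (sym (D-push s′ w)) last)
  where
  endsEarlier : _ → _
  endsEarlier (inj₁ D<M) = inj₁ (subst₂ _<_ (sym (D-push s w)) (sym (M-push s w)) D<M)
  endsEarlier (inj₂ D≡0) = inj₂ (trans (D-push s w) D≡0)

-- Evolution of the thresholds under appended entries.

-- All active windows share the suffix sum V of the current run of positive entries and
-- have the threshold M − D = g; a dormant window is a suffix of that run, with D = M = m.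
record State (n : ℕ) (a : Signal) (t r : ℕ) : Set where
  field
    V                : ℕ
    dormant active   : List ℕ
    dormant-length   : length dormant ≡ r
    active-length    : length active ≡ t
    dormant-sorted   : AllPairs _<_ (0 ∷ dormant)
    active-sorted    : AllPairs _<_ (0 ∷ active)
    dormant-bounded  : All (_≤ V) dormant
    dormant-windows  : All (λ m → Window n a m m) dormant
    active-windows   : All (λ g → Window n a V (V + g)) active

state-empty : ∀ n a → State n a 0 0
state-empty n a = record
  { V = 0 ; dormant = [] ; active = [] ; dormant-length = refl ; active-length = refl
  ; dormant-sorted = [] ∷ [] ; active-sorted = [] ∷ [] ; dormant-bounded = []
  ; dormant-windows = [] ; active-windows = [] }

-- The odd number is the integer for which doubling makes room between the thresholds `m` and `n`.
1+2*-< : ∀ {m n} → m < n → suc (2 * m) < 2 * n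
1+2*-< {m} {n} m<n = subst (_≤ 2 * n) (*-suc 2 m) (*-monoʳ-≤ 2 m<n)

module _ {n a t r} (st : State n a t r) where

  open State st

  -- Every window has suffix sum at most `V`, so a drop by `2 * V` clears them all and each doubled
  -- maximum becomes a threshold. Dormant maxima are at most `V` and active ones exceed it, so all
  -- `t + r` stay distinct.
  state-down : State (suc n) (push n (down (2 * V)) a) (t + r) 0
  state-down = record
    { V = 0 ; dormant = [] ; active = map (2 *_) maxima ; dormant-length = refl
    ; active-length = begin
        length (map (2 *_) maxima)                       ≡⟨ length-map (2 *_) maxima ⟩
        length maxima                                    ≡⟨ length-++ dormant ⟩
        length dormant + length (map (_+_ V) active)     ≡⟨ cong₂ _+_ dormant-length (trans (length-map (_+_ V) active) active-length) ⟩
        r + t                                            ≡⟨ +-comm r t ⟩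
        t + r                                            ∎
    ; dormant-sorted = [] ∷ []
    ; active-sorted = AllPairs.map⁺ (AllPairs.map (*-monoʳ-< 2) maxima-sorted)
    ; dormant-bounded = [] ; dormant-windows = []
    ; active-windows = All.map⁺ (All.map reset maxima-windows) }
    where
    open ≡-Reasoning
    maxima : List ℕ
    maxima = dormant ++ map (_+_ V) active
    active-positive : All (0 <_) active
    active-positive = AllPairs.head active-sorted
    maxima-sorted : AllPairs _<_ (0 ∷ maxima)
    maxima-sorted = AllPairs.++⁺ dormant-sorted
      (AllPairs.map⁺ (AllPairs.map (+-monoʳ-< V) (AllPairs.tail active-sorted)))
      (All.map (λ m≤V → All.map⁺ (All.map (λ 0<g → ≤-<-trans m≤V (m<m+n V 0<g)) active-positive))
        (z≤n ∷ dormant-bounded))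
    maxima-windows : All (λ m → ∃ λ d → d ≤ V × Window n a d m) maxima
    maxima-windows = All.++⁺
      (All.map (λ (m≤V , w) → _ , m≤V , w) (All.zip (dormant-bounded , dormant-windows)))
      (All.map⁺ (All.map (λ w → V , ≤-refl , w) active-windows))
    reset : ∀ {m} → (∃ λ d → d ≤ V × Window n a d m) → Window (suc n) (push n (down (2 * V)) a) 0 (2 * m)
    reset {m} (d , d≤V , w) with i , l , end , D≡ , M≡ ← window-push (down (2 * V)) w =
      i , l , end , trans D≡ clipped , trans M≡ (trans (cong (2 * m ⊔_) clipped) (⊔-identityʳ (2 * m)))
      where
      clipped : 2 * d ∸ 2 * V ≡ 0
      clipped = m≤n⇒m∸n≡0 (*-monoʳ-≤ 2 d≤V)

  -- `τ` stands for the largest threshold to be exceeded, or 0, and `gs` for those that survive. The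
  -- new value lies strictly between the doubles of `τ` and of all of `gs`; windows whose threshold
  -- it exceeds are dropped.
  state-up : ∀ {τ gs} → AllPairs _<_ (τ ∷ gs) → All (λ g → Window n a V (V + g)) gs →
    State (suc n) (push n (up (suc (2 * τ))) a) (length gs) (suc r)
  state-up {τ} {gs} (τ<gs ∷ gs-sorted) gs-windows = record
    -- The head `v` is the window of the new entry alone, the shortest suffix of the run. The
    -- appended value raises the common suffix sum but not the active maxima, so their gaps shrink
    -- by `v`.
    { V = 2 * V + v ; dormant = v ∷ map (λ m → 2 * m + v) dormant ; active = map (λ g → 2 * g ∸ v) gs
    ; dormant-length = cong suc (trans (length-map _ dormant) dormant-length)
    ; active-length = length-map _ gs
    ; dormant-sorted =
        (z<s ∷ All.map⁺ (All.map (λ {m} _ → <-≤-trans z<s (m≤n+m v (2 * m))) dormant-bounded))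
        ∷ All.map⁺ (All.map (λ {m} 0<m → m<n+m v (*-monoʳ-< 2 0<m)) (AllPairs.head dormant-sorted))
        ∷ AllPairs.map⁺ (AllPairs.map (λ lt → +-monoˡ-< v (*-monoʳ-< 2 lt)) (AllPairs.tail dormant-sorted))
    ; active-sorted =
        All.map⁺ (All.map (λ τ<g → m<n⇒0<n∸m (1+2*-< τ<g)) τ<gs)
        ∷ gaps-sorted τ<gs gs-sorted
    ; dormant-bounded = m≤n+m v (2 * V) ∷ All.map⁺ (All.map (λ m≤V → +-monoˡ-≤ v (*-monoʳ-≤ 2 m≤V)) dormant-bounded)
    ; dormant-windows = window-push (up v) (window-empty n a) ∷ All.map⁺ (All.map lift dormant-windows)
    ; active-windows = All.map⁺ (All.map keep (All.zip (τ<gs , gs-windows)))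
    }
    where
    v : ℕ
    v = suc (2 * τ)
    v≤2* : ∀ {g} → τ < g → v ≤ 2 * g
    v≤2* τ<g = <⇒≤ (1+2*-< τ<g)
    gaps-sorted : ∀ {gs} → All (τ <_) gs → AllPairs _<_ gs → AllPairs _<_ (map (λ g → 2 * g ∸ v) gs)
    gaps-sorted []           []              = []
    gaps-sorted (τ<g ∷ τ<gs) (g<gs ∷ sorted) =
      All.map⁺ (All.map (λ g<g′ → ∸-monoˡ-< (*-monoʳ-< 2 g<g′) (v≤2* τ<g)) g<gs) ∷ gaps-sorted τ<gs sorted
    lift : ∀ {m} → Window n a m m → Window (suc n) (push n (up v) a) (2 * m + v) (2 * m + v)
    lift {m} w with i , l , end , D≡ , M≡ ← window-push (up v) w =
      i , l , end , D≡ , trans M≡ (m≤n⇒m⊔n≡n (m≤m+n (2 * m) v))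
    keep : ∀ {g} → τ < g × Window n a V (V + g) →
      Window (suc n) (push n (up v) a) (2 * V + v) (2 * V + v + (2 * g ∸ v))
    keep {g} (τ<g , w) with i , l , end , D≡ , M≡ ← window-push (up v) w =
      i , l , end , D≡ , trans M≡ (trans (m≥n⇒m⊔n≡m below) (sym total))
      where
      open ≡-Reasoning
      total : 2 * V + v + (2 * g ∸ v) ≡ 2 * (V + g)
      total = begin
        2 * V + v + (2 * g ∸ v)     ≡⟨ +-assoc (2 * V) v (2 * g ∸ v) ⟩
        2 * V + (v + (2 * g ∸ v))   ≡⟨ cong (_+_ (2 * V)) (m+[n∸m]≡n (v≤2* τ<g)) ⟩
        2 * V + 2 * g               ≡⟨ *-distribˡ-+ 2 V g ⟨
        2 * (V + g)                 ∎
      below : 2 * V + v ≤ 2 * (V + g)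
      below = subst (2 * V + v ≤_) total (m≤m+n (2 * V + v) (2 * g ∸ v))

-- Families of pairwise separated signals.

Family : ℕ → (Signal → Set) → ℕ → Set
Family n P c = ∃ λ as → length as ≡ c × All P as × AllPairs (Separated n) as

family-singleton : ∀ {n P} a → P a → Family n P 1
family-singleton a pa = a ∷ [] , refl , pa ∷ [] , [] ∷ []

family-map : ∀ {n P Q c} → (∀ {a} → P a → Q a) → Family n P c → Family n Q c
family-map P⇒Q (as , len , ps , sep) = as , len , All.map P⇒Q ps , sep

family-join : ∀ {n c d} {P Q R : Signal → Set} → (∀ {a b} → Q a → R b → Separated n a b) →
  (∀ {a} → Q a → P a) → (∀ {b} → R b → P b) → Family n Q c → Family n R d → Family n P (c + d)
family-join cross Q⇒P R⇒P (as , refl , qs , sep) (bs , refl , rs , sep′) =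
  as ++ bs , length-++ as , All.++⁺ (All.map Q⇒P qs) (All.map R⇒P rs) ,
  AllPairs.++⁺ sep sep′ (All.map (λ q → All.map (cross q) rs) qs)

-- Each member is replaced by a family of its extensions. Descendants of different members inherit
-- the separation of their ancestors.
family-extend : ∀ {k m n a c d} → k ≤ m → m ≤ n → Family m (Extends k a) c →
  (∀ b → Family n (Extends m b) d) → Family n (Extends k a) (c * d)
family-extend {m = m} {n} {d = d} k≤m m≤n (as , refl , exts , sep) children =
  family-map through (go sep)
  where
  through : ∀ {c} → Any (λ b → Extends m b c) as → Extends _ _ c
  through any with ext , ext′ ← All.lookupAny exts any = extends-trans k≤m ext ext′
  -- `Any` keeps track of an ancestor, from which the separation is inherited.
  go : ∀ {bs} → AllPairs (Separated m) bs → Family n (λ c → Any (λ b → Extends m b c) bs) (length bs * d)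
  go []                        = [] , refl , [] , []
  go {b ∷ bs} (b-sep ∷ bs-sep) = family-join cross here there (children b) (go bs-sep)
    where
    cross : ∀ {x y} → Extends m b x → Any (λ b → Extends m b y) bs → Separated n x y
    cross ext any with s , ext′ ← All.lookupAny b-sep any = separated-extends m≤n s ext ext′

-- The counting recurrence and arrays that realize it.

Σ< : ℕ → (ℕ → ℕ) → ℕ
Σ< zero    f = 0
Σ< (suc t) f = f t + Σ< t f

-- count m t r bounds from below the number of distinguishable ways to append m entries
-- to an array with t active and r dormant windows.
count : ℕ → ℕ → ℕ → ℕ
count zero    t r = 1
count (suc m) t r = count m (t + r) 0 + Σ< (suc t) (λ s → count m s (suc r))

-- Branches over one negative entry and, for each number `s` of surviving thresholds, one positive
-- entry.
grow : ∀ m {n a t r} → State n a t r → Family (m + n) (Extends n a) (count m t r)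
grow zero    {a = a} st = family-singleton a extends-refl
grow (suc m) {n} {a} {t} {r} st =
  subst (λ N → Family N (Extends n a) (count (suc m) t r)) (+-suc m n)
    (family-join down-up push⇒extends above⇒extends
      (grow m (state-down st))
      (subst (λ t → Family (m + suc n) (Above 0) (Σ< (suc t) (λ s → count m s (suc r)))) active-length
        (ups active-sorted active-windows)))
  where
  open State st
  1+n≤ : suc n ≤ m + suc n
  1+n≤ = m≤n+m (suc n) m
  -- Remembering only that the appended value passes `2 * τ` lets one comparison settle all the
  -- later branches at once.
  Above : ℕ → Signal → Set
  Above τ b = ∃ λ v → 2 * τ < v × Extends (suc n) (push n (up v) a) b
  push⇒extends : ∀ {s b} → Extends (suc n) (push n s a) b → Extends n a b
  push⇒extends = extends-trans (n≤1+n n) (push-extends n _ a)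
  above⇒extends : ∀ {b} → Above 0 b → Extends n a b
  above⇒extends (_ , _ , ext) = push⇒extends ext
  -- The query on the new entry alone tells its sign.
  down-up : ∀ {b c} → Extends (suc n) (push n (down (2 * V)) a) b → Above 0 c → Separated (m + suc n) b c
  down-up extb (v , 0<v , extc) = separated-extends 1+n≤
    (separated-push (window-empty n a) (inj₂ (0∸n≡0 (2 * V))) 0<v) extb extc
  -- The first branch stays below the least surviving threshold `g`; the window of `g` separates it
  -- from all further ones, which exceed `g`.
  ups : ∀ {τ gs} → AllPairs _<_ (τ ∷ gs) → All (λ g → Window n a V (V + g)) gs →
    Family (m + suc n) (Above τ) (Σ< (suc (length gs)) (λ s → count m s (suc r)))
  ups {τ} sorted [] = subst (Family _ _) (sym (+-identityʳ _)) (family-map (λ ext → _ , ≤-refl , ext) (grow m (state-up st sorted [])))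
  ups {τ} {g ∷ gs} sorted@((τ<g ∷ _) ∷ gs-sorted) (w ∷ ws) =
    family-join cross (λ ext → _ , ≤-refl , ext)
      (λ (v , 2g<v , ext) → v , <-trans (*-monoʳ-< 2 τ<g) 2g<v , ext)
      (grow m (state-up st sorted (w ∷ ws))) (ups gs-sorted ws)
    where
    cross : ∀ {b c} → Extends (suc n) (push n (up (suc (2 * τ))) a) b → Above g c → Separated (m + suc n) b c
    cross extb (v , 2g<v , extc) = separated-extends 1+n≤
      (separated-push w
        (inj₁ (subst (2 * V + suc (2 * τ) <_) (sym (*-distribˡ-+ 2 V g)) (+-monoʳ-< (2 * V) (1+2*-< τ<g))))
        (subst (_< 2 * V + v) (sym (*-distribˡ-+ 2 V g)) (+-monoʳ-< (2 * V) 2g<v)))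
      extb extc

-- Evaluation of the recurrence.

-- Unfolding count takes exponential time; its values are computed by dynamic
-- programming, with row r and column t of table size m holding count m t r.
data Tabulates {A : Set} (R : ℕ → A → Set) : ℕ → List A → Set where
  []  : ∀ {i} → Tabulates R i []
  _∷_ : ∀ {i x xs} → R i x → Tabulates R (suc i) xs → Tabulates R i (x ∷ xs)

Row : ℕ → ℕ → List ℕ → Set
Row m r = Tabulates (λ t x → x ≡ count m t r) 0

prefixSums : ℕ → List ℕ → List ℕ
prefixSums acc []       = []
prefixSums acc (x ∷ xs) = x + acc ∷ prefixSums (x + acc) xs

-- New row `r` adds the old row 0 shifted by `r`, whose head is dropped at each row, to the prefix
-- sums of old row `r + 1`.
nextRows : List ℕ → List (List ℕ) → List (List ℕ)
nextRows (c ∷ cs) (row ∷ rows) = zipWith _+_ (c ∷ cs) (prefixSums 0 row) ∷ nextRows cs rows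
nextRows _        _            = []

nextTable : List (List ℕ) → List (List ℕ)
nextTable []           = []
nextTable (row ∷ rows) = nextRows row rows

table : ℕ → ℕ → List (List ℕ)
table size zero    = replicate size (replicate size 1)
table size (suc m) = nextTable (table size m)

tabulates-replicate : ∀ {A : Set} {R : ℕ → A → Set} {x} → (∀ i → R i x) →
  ∀ n {i} → Tabulates R i (replicate n x)
tabulates-replicate r zero    = []
tabulates-replicate r (suc n) = r _ ∷ tabulates-replicate r n

prefixSums-tabulates : ∀ {f t acc xs} → acc ≡ Σ< t f → Tabulates (λ i x → x ≡ f i) t xs →
  Tabulates (λ i x → x ≡ Σ< (suc i) f) t (prefixSums acc xs)
prefixSums-tabulates eq []         = []
prefixSums-tabulates refl (refl ∷ xs) = refl ∷ prefixSums-tabulates refl xs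

zipWith-tabulates : ∀ {f g : ℕ → ℕ} {r i xs ys} → Tabulates (λ j x → x ≡ f j) (i + r) xs →
  Tabulates (λ j y → y ≡ g j) i ys → Tabulates (λ j z → z ≡ f (j + r) + g j) i (zipWith _+_ xs ys)
zipWith-tabulates []          _           = []
zipWith-tabulates (_ ∷ _)     []          = []
zipWith-tabulates (refl ∷ xs) (refl ∷ ys) = refl ∷ zipWith-tabulates xs ys

nextRows-tabulates : ∀ m {r cs rows} → Tabulates (λ t x → x ≡ count m t 0) r cs →
  Tabulates (Row m) (suc r) rows → Tabulates (Row (suc m)) r (nextRows cs rows)
nextRows-tabulates m []           _            = []
nextRows-tabulates m (_ ∷ _)      []           = []
nextRows-tabulates m (c ∷ cs) (row ∷ rows) =
  zipWith-tabulates (c ∷ cs) (prefixSums-tabulates refl row) ∷ nextRows-tabulates m cs rows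

table-tabulates : ∀ size m → Tabulates (Row m) 0 (table size m)
table-tabulates size zero = tabulates-replicate (λ _ → tabulates-replicate (λ _ → refl) size) size
table-tabulates size (suc m) with table size m | table-tabulates size m
... | []         | []           = []
... | row ∷ rows | row✓ ∷ rows✓ = nextRows-tabulates m row✓ rows✓

corner : List (List ℕ) → ℕ
corner ((x ∷ _) ∷ _) = x
corner _             = 0

-- Tables may run short, as `Tabulates` fixes no length; the default 0 of `corner` is then still a
-- lower bound.
corner-≤ : ∀ m {rows} → Tabulates (Row m) 0 rows → corner rows ≤ count m 0 0
corner-≤ m []               = z≤n
corner-≤ m ([] ∷ _)         = z≤n
corner-≤ m ((refl ∷ _) ∷ _) = ≤-refl

table-≤-count : ∀ size m → corner (table size m) ≤ count m 0 0
table-≤-count size m = corner-≤ m (table-tabulates size m)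

-- From independent blocks to code lengths.

-- Each block restarts from `state-empty`, forgetting the windows of earlier blocks, so the counts
-- multiply.
blocks : ∀ m q {n} a → Family (n + q * m) (Extends n a) (count m 0 0 ^ q)
blocks m zero {n} a = subst (λ N → Family N (Extends n a) 1) (sym (+-identityʳ n)) (family-singleton a extends-refl)
blocks m (suc q) {n} a = subst (λ N → Family N (Extends n a) (count m 0 0 ^ suc q)) total
  (family-extend (m≤n+m n m) (m≤m+n (m + n) (q * m)) (grow m (state-empty n a)) (λ b → blocks m q b))
  where
  total : m + n + q * m ≡ n + (m + q * m)
  total = trans (cong (_+ q * m) (+-comm m n)) (+-assoc n m (q * m))

Bool↣2 : Bool ↣ Fin 2
Bool↣2 = ↔⇒↣ (↔-sym 2↔Bool)

toFin : ∀ {b} → Vec Bool b → Fin (2 ^ b)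
toFin xs = funToFin (Injection.to Bool↣2 ∘ Vec.lookup xs)

toFin-injective : ∀ {b} {xs ys : Vec Bool b} → toFin xs ≡ toFin ys → xs ≡ ys
toFin-injective {xs = xs} {ys} eq = begin
  xs                              ≡⟨ Vec.tabulate∘lookup xs ⟨
  Vec.tabulate (Vec.lookup xs)    ≡⟨ Vec.tabulate-cong same ⟩
  Vec.tabulate (Vec.lookup ys)    ≡⟨ Vec.tabulate∘lookup ys ⟩
  ys                              ∎
  where
  open ≡-Reasoning
  same : ∀ k → Vec.lookup xs k ≡ Vec.lookup ys k
  same k = Injection.injective Bool↣2 (trans (sym (finToFun-funToFin _ k))
    (trans (cong (λ c → finToFun c k) eq) (finToFun-funToFin _ k)))

allPairs-lookup-injective : ∀ {A B : Set} {f : A → B} {xs} → AllPairs (λ x y → f x ≢ f y) xs →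
  ∀ {i j} → f (lookup xs i) ≡ f (lookup xs j) → i ≡ j
allPairs-lookup-injective (_ ∷ _)    {Fin.zero}  {Fin.zero}  _  = refl
allPairs-lookup-injective (x≢ ∷ _)   {Fin.zero}  {Fin.suc j} eq = contradiction eq (All.lookup x≢ (∈-lookup j))
allPairs-lookup-injective (x≢ ∷ _)   {Fin.suc i} {Fin.zero}  eq = contradiction (sym eq) (All.lookup x≢ (∈-lookup i))
allPairs-lookup-injective (_ ∷ diff) {Fin.suc i} {Fin.suc j} eq = cong Fin.suc (allPairs-lookup-injective diff eq)

-- Two separated signals with the same code would share a decoded answer at the separating query, so
-- the encoder is injective on the family.
family-≤-codes : ∀ {n b P c} → Family n P c →
  (enc : Array n → Vec Bool b) (dec : Vec Bool b → Fin n → Fin n → Maybe (Fin n × Fin n)) →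
  (∀ A (i j : Fin n) → toℕ i ≤ toℕ j → IsRMaxSSQ A i j (dec (enc A) i j)) → c ≤ 2 ^ b
family-≤-codes {n} (as , refl , _ , sep) enc dec correct =
  injective⇒≤ {f = λ k → toFin (enc (array (lookup as k)))}
    (λ eq → allPairs-lookup-injective (AllPairs.map distinct sep) (toFin-injective eq))
  where
  distinct : ∀ {a b} → Separated n a b → enc (array a) ≢ enc (array b)
  distinct {a} {b} s eq with i , j , i≤j , clash ← separated-answers s =
    clash (correct (array a) i j i≤j)
      (subst (λ c → IsRMaxSSQ (array b) i j (dec c i j)) (sym eq) (correct (array b) i j i≤j))

-- Arithmetic of the final bound.

-- `k / s` is the claimed rate and `p` the bits per block of `m` entries; the `r` leftover entries,
-- at most one block, are charged `s * p`.
linear-bound : ∀ k s {m p r} q → r ≤ m → k * m ≤ s * p → k * (r + q * m) ≤ s * (p * q) + s * p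
linear-bound k s {m} {p} {r} q r≤m km≤sp = begin
  k * (r + q * m)        ≡⟨ *-distribˡ-+ k r (q * m) ⟩
  k * r + k * (q * m)    ≡⟨ cong (λ x → k * r + k * x) (*-comm q m) ⟩
  k * r + k * (m * q)    ≡⟨ cong (_+_ (k * r)) (*-assoc k m q) ⟨
  k * r + k * m * q      ≤⟨ +-mono-≤ (≤-trans (*-monoʳ-≤ k r≤m) km≤sp) (*-monoˡ-≤ q km≤sp) ⟩
  s * p + s * p * q      ≡⟨ cong (_+_ (s * p)) (*-assoc s p q) ⟩
  s * p + s * (p * q)    ≡⟨ +-comm (s * p) _ ⟩
  s * (p * q) + s * p    ∎
  where open ≤-Reasoning

-- Exponential form of `x ≤ s * b + s * c * lg n`, free of logarithms. The additive constant is
-- absorbed because `lg n` is at least 1.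
power-bound : ∀ {x y} s b {c n} → 2 ≤ n → x ≤ s * y + s * c → 2 ^ y ≤ 2 ^ b →
  2 ^ x ≤ 2 ^ (s * b) * n ^ (s * c)
power-bound {x} {y} s b {c} {n} 2≤n x≤ 2^y≤2^b = begin
  2 ^ x                        ≤⟨ ^-monoʳ-≤ 2 x≤ ⟩
  2 ^ (s * y + s * c)          ≡⟨ ^-distribˡ-+-* 2 (s * y) (s * c) ⟩
  2 ^ (s * y) * 2 ^ (s * c)    ≤⟨ *-mono-≤ grows (^-monoˡ-≤ (s * c) 2≤n) ⟩
  2 ^ (s * b) * n ^ (s * c)    ∎
  where
  open ≤-Reasoning
  grows : 2 ^ (s * y) ≤ 2 ^ (s * b)
  grows = begin
    2 ^ (s * y)    ≡⟨ cong (2 ^_) (*-comm s y) ⟩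
    2 ^ (y * s)    ≡⟨ ^-*-assoc 2 y s ⟨
    (2 ^ y) ^ s    ≤⟨ ^-monoˡ-≤ s 2^y≤2^b ⟩
    (2 ^ b) ^ s    ≡⟨ ^-*-assoc 2 b s ⟩
    2 ^ (b * s)    ≡⟨ cong (2 ^_) (*-comm b s) ⟩
    2 ^ (s * b)    ∎

codes-bound : ∀ m .{{_ : NonZero m}} p k s → 2 ^ p ≤ count m 0 0 → k * m ≤ s * p →
  ∀ n → 2 ≤ n → ∀ b (enc : Array n → Vec Bool b) (dec : Vec Bool b → Fin n → Fin n → Maybe (Fin n × Fin n)) →
  (∀ (A : Array n) (i j : Fin n) → toℕ i ≤ toℕ j → IsRMaxSSQ A i j (dec (enc A) i j)) →
  2 ^ (k * n) ≤ 2 ^ (s * b) * n ^ (s * p)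
codes-bound m p k s 2^p≤count km≤sp n 2≤n b enc dec correct = power-bound s b 2≤n exponent codes
  where
  q r : ℕ
  q = n / m
  r = n % m
  n≡ : n ≡ r + q * m
  n≡ = m≡m%n+[m/n]*n n m
  exponent : k * n ≤ s * (p * q) + s * p
  exponent = subst (λ n → k * n ≤ s * (p * q) + s * p) (sym n≡)
    (linear-bound k s q (<⇒≤ (m%n<n n m)) km≤sp)
  -- The `r` leftover entries form a common prefix of zeros.
  family : Family n (Extends r (λ _ → up 0)) (count m 0 0 ^ q)
  family = subst (λ N → Family N (Extends r (λ _ → up 0)) (count m 0 0 ^ q)) (sym n≡) (blocks m q (λ _ → up 0))
  codes : 2 ^ (p * q) ≤ 2 ^ b
  codes = begin
    2 ^ (p * q)       ≡⟨ ^-*-assoc 2 p q ⟨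
    (2 ^ p) ^ q       ≤⟨ ^-monoˡ-≤ q 2^p≤count ⟩
    count m 0 0 ^ q   ≤⟨ family-≤-codes family enc dec correct ⟩
    2 ^ b             ∎
    where open ≤-Reasoning

theorem2 : ∃[ c ] ∃[ N ] ∀ (n : ℕ) → N ≤ n → ∀ (b : ℕ)
    → (enc : Array n → Vec Bool b)
    → (dec : Vec Bool b → Fin n → Fin n → Maybe (Fin n × Fin n))
    → (∀ (A : Array n) (i j : Fin n) → toℕ i ≤ toℕ j
    → IsRMaxSSQ A i j (dec (enc A) i j))
    → 2 ^ (189113 * n) ≤ 2 ^ (100000 * b) * n ^ (100000 * c)
-- The constant 67 pays for one incomplete block, and `n` at least 2 makes `lg n` at least 1.
theorem2 = 67 , 2 , codes-bound 35 67 189113 100000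
  -- Each step of the table uses up one row, so 36 rows leave one after 35 steps.
  (≤-trans (≤ᵇ⇒≤ (2 ^ 67) (corner (table 36 35)) _) (table-≤-count 36 35))
  (≤ᵇ⇒≤ (189113 * 35) (100000 * 67) _)
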